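{- For every $\mathtt{NI}^\bullet$-derivation $\mathscr D$, one has $\mathscr D^*\simeq_{\beta\eta\varepsilon}\mathscr D^{*\downarrow}$ and $\mathscr D^*\simeq_{\beta\eta\varepsilon}\mathscr D^\sharp$ (equivalences of $\mathtt{NI}^2$-derivations), where $\mathscr D^*$ is the RP-translation, $\mathscr D^{*\downarrow}$ the FF-translation and $\mathscr D^\sharp$ the ESF-translation of $\mathscr D$.
   Context: Derivations are written as typed $\lambda$-terms; type information is regarded as part of the term, though not displayed, and translations are defined by recursion on derivations. Formulas. $\mathcal L^\bullet$: $A::=X\mid A\supset B\mid\bullet(A,B,C)$. $\mathcal L^2$: $A::=X\mid A\supset B\mid\forall X.A$. $\mathtt{NI}^\bullet$ (over $\mathcal L^\bullet$) has the usual rules for assumptions and $\supset$ (terms $x,\lambda x.t,tu$), and for $\bullet$ (which behaves like $(A_1\wedge A_2)\vee A_3$): from $t_1:A_1$, $t_2:A_2$ infer $\iota^1(t_1,t_2):\bullet(A_1,A_2,A_3)$; from $t_3:A_3$ infer $\iota^2(t_3):\bullet(A_1,A_2,A_3)$; from $t:\bullet(A_1,A_2,A_3)$, from $s_1:C$ under additional assumptions $y_1:A_1,y_2:A_2$, and from $s_2:C$ under additional assumption $y_3:A_3$, infer $\delta(t,\,y_1y_2.s_1,\,y_3.s_2):C$ (discharging $y_1,y_2,y_3$). $\mathtt{NI}^2$ (over $\mathcal L^2$) is System F: terms $x,\lambda x.t,tu,\Lambda X.t,tB$, where $\Gamma\vdash t:A$ with $X\notin FV(\Gamma)$ gives $\Lambda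 X.t:\forall X.A$, and $t:\forall X.A$ gives $tB:A\llbracket B/X\rrbracket$. Equivalence $\simeq_{\beta\eta\varepsilon}$ on $\mathtt{NI}^2$: the least typed congruence (reflexive, symmetric, transitive) generated by $(\lambda x.t)s\simeq t\llbracket s/x\rrbracket$; $(\Lambda X.t)B\simeq t\llbracket B/X\rrbracket$; $t\simeq\lambda x.tx$ ($x\notin FV(t)$, $t$ of implication type); $t\simeq\Lambda X.tX$ ($X\notin FV(t)$, $t$ of universal type); and the rule $\varepsilon$: for a universal polynomial formula $\forall X.G_1\supset\dots\supset G_n\supset X$ with $G_k=A_{k1}\supset\dots\supset A_{km_k}\supset X$ and $X$ not free in the $A_{kj}$ ($n,m_k\ge0$), if $t$ has this type in typing context $\Gamma$, $\Gamma\vdash u_k:G_k\llbracket C/X\rrbracket$ for $1\le k\le n$, and $\mathtt U$ is a term context with $\Gamma,x:C\vdash\mathtt U[x]:D$, then $\mathtt U[t\,C\,u_1\cdots u_n]\simeq t\,D\,v_1\cdots v_n$ where $v_k=\lambda w_1\dots\lambda w_{m_k}.\mathtt U[u_kw_1\cdots w_{m_k}]$ with fresh $w$'s. A term context is a term with a hole $[\ ]$ (occurring any finite number of times); $\mathtt U[t]$ is capture-avoiding and $\mathtt U\{t\}$ is variable-capturing substitution for the hole. RP-translation. $X^*=X$, $(A\supset B)^*=A^*\supset B^*$, $\bullet(A_1,A_2,A_3)^*=\forall X.(A_1^*\supset A_2^*\supset X)\supset(A_3^*\supset X)\supset X$ ($X$ fresh). $x^*=x$, $(\lambda x.t)^*=\lambda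 x.t^*$, $(ts)^*=t^*s^*$, $(\iota^1(t_1,t_2))^*=\Lambda X.\lambda x_1.\lambda x_2.x_1t_1^*t_2^*$, $(\iota^2(t_3))^*=\Lambda X.\lambda x_1.\lambda x_2.x_2t_3^*$, and for a $\delta$-term of type $C$: $(\delta(t,y_1y_2.s_1,y_3.s_2))^*=t^*\,C^*\,(\lambda y_1.\lambda y_2.s_1^*)\,(\lambda y_3.s_2^*)$. FF-atomization and FF-translation. $(\cdot)^\downarrow$ is defined on derivations of the fragment of $\mathtt{NI}^2$ in which all universal formulas have the form $\forall X.(A\supset B\supset X)\supset(C\supset X)\supset X$ with $X$ not free in $A,B,C$ (this contains all $\mathscr D^*$). It commutes with variables, $\lambda$, application, $\Lambda$ and with $tY$ for $Y$ a variable, and for $t:\forall X.(A\supset B\supset X)\supset(C\supset X)\supset X$: $(t(F_1\supset F_2))^\downarrow=\lambda k_1.\lambda k_2.\lambda m.(tF_2)^\downarrow(\lambda a.\lambda b.k_1\,a\,b\,m)(\lambda c.k_2\,c\,m)$; $(t(\forall Z.F'))^\downarrow=\lambda k_1.\lambda k_2.\Lambda Z.(tF')^\downarrow(\lambda a.\lambda b.k_1\,a\,b\,Z)(\lambda c.k_2\,c\,Z)$. The FF-translation of $\mathscr D$ is $\mathscr D^{*\downarrow}=(\mathscr D^*)^\downarrow$. ESF-translation. $\mathsf{at}(B)$ is the rightmost variable of $B\in\mathcal L^2$. Contexts $\mathtt{El}_B,\mathtt{In}_B$ use the same fresh variables: $\mathtt{El}_Z=\mathtt{In}_Z=[\ ]$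 for $Z$ a variable; $\mathtt{El}_{C\supset D}=\mathtt{El}_D[[\ ]x]$, $\mathtt{In}_{C\supset D}=\lambda x.\mathtt{In}_D$; $\mathtt{El}_{\forall X.D}=\mathtt{El}_D[[\ ]X]$, $\mathtt{In}_{\forall X.D}=\Lambda X.\mathtt{In}_D$ (if the rightmost variable is bound in $B$, $\mathsf{at}(B)$ denotes the corresponding type variable used in $\mathtt{El}_B,\mathtt{In}_B$). $(\cdot)^\sharp$ is defined on $\mathtt{NI}^\bullet$-derivations by the same clauses as $(\cdot)^*$ (with $\sharp$ in place of $*$ on terms), except that for a $\delta$-term of type $C$ with $Z=\mathsf{at}(C^*)$: $(\delta(t,y_1y_2.s_1,y_3.s_2))^\sharp=\mathtt{In}_{C^*}\{t^\sharp\,Z\,(\lambda y_1.\lambda y_2.\mathtt{El}_{C^*}[s_1^\sharp])\,(\lambda y_3.\mathtt{El}_{C^*}[s_2^\sharp])\}$. -}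

module Defs where

open import Data.Nat using (ℕ; suc)
open import Data.Fin using (Fin; zero; suc; lift)
open import Data.List using (List; []; _∷_; map; foldr; foldl; zipWith)
open import Data.List.Relation.Binary.Pointwise using (Pointwise)
open import Data.Vec using (Vec; _∷_; lookup)
import Data.Vec as Vec
open import Data.Vec.Functional using () renaming (_∷_ to _◂_)
open import Function using (id; _∘_)
open import Relation.Binary.PropositionalEquality using (_≡_; refl; sym; trans; cong; cong₂; subst)

infix  4 _⊢•_ _⊢_∶_ _⊢_≃_∶_
infixr 5 _⇒_
infixr 6 _⊃_
infixl 7 _·_ _∙⟨_⟩_
infixl 8 _[_] _[_]ᵗ _[_]ᵀ

private variable
  n n′ m m′ : ℕ

------------------------------------------------------------------------
-- NI•.  Formulas have their variables among n; derivations are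
-- intrinsically typed and variables are de Bruijn indices, so in
-- A₂ ∷ A₁ ∷ Γ index 0 is y₂ and index 1 is y₁.

data Form (n : ℕ) : Set where
  var : Fin n → Form n
  _⊃_ : Form n → Form n → Form n
  •   : Form n → Form n → Form n → Form n

data _⊢•_ {n m : ℕ} (Γ : Vec (Form n) m) : Form n → Set where
  var : (x : Fin m) → Γ ⊢• lookup Γ x
  ƛ   : ∀ {A B} → A ∷ Γ ⊢• B → Γ ⊢• A ⊃ B
  _·_ : ∀ {A B} → Γ ⊢• A ⊃ B → Γ ⊢• A → Γ ⊢• B
  ι¹  : ∀ {A₁ A₂ A₃} → Γ ⊢• A₁ → Γ ⊢• A₂ → Γ ⊢• • A₁ A₂ A₃
  ι²  : ∀ {A₁ A₂ A₃} → Γ ⊢• A₃ → Γ ⊢• • A₁ A₂ A₃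
  δ   : ∀ {A₁ A₂ A₃ C} → Γ ⊢• • A₁ A₂ A₃ →
        A₂ ∷ A₁ ∷ Γ ⊢• C → A₃ ∷ Γ ⊢• C → Γ ⊢• C

------------------------------------------------------------------------
-- NI².  Terms are fully annotated: Λ A t has type ∀′ A, and t ∙⟨ A ⟩ B
-- is the instantiation at B of a term t of type ∀′ A.  A term together
-- with its context therefore determines its typing derivation.

data Ty (n : ℕ) : Set where
  var : Fin n → Ty n
  _⊃_ : Ty n → Ty n → Ty n
  ∀′  : Ty (suc n) → Ty n

data Tm (n m : ℕ) : Set where
  var    : Fin m → Tm n m
  ƛ      : Ty n → Tm n (suc m) → Tm n m
  _·_    : Tm n m → Tm n m → Tm n m
  Λ      : Ty (suc n) → Tm (suc n) m → Tm n m
  _∙⟨_⟩_ : Tm n m → Ty (suc n) → Ty n → Tm n m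

Ctx : ℕ → ℕ → Set
Ctx n m = Vec (Ty n) m

renᵗ : (Fin n → Fin n′) → Ty n → Ty n′
renᵗ ρ (var X) = var (ρ X)
renᵗ ρ (A ⊃ B) = renᵗ ρ A ⊃ renᵗ ρ B
renᵗ ρ (∀′ A)  = ∀′ (renᵗ (lift 1 ρ) A)

wkᵗ : Ty n → Ty (suc n)
wkᵗ = renᵗ suc

liftᵗ : (Fin n → Ty n′) → Fin (suc n) → Ty (suc n′)
liftᵗ σ = var zero ◂ (wkᵗ ∘ σ)

subᵗ : (Fin n → Ty n′) → Ty n → Ty n′
subᵗ σ (var X) = σ X
subᵗ σ (A ⊃ B) = subᵗ σ A ⊃ subᵗ σ B
subᵗ σ (∀′ A)  = ∀′ (subᵗ (liftᵗ σ) A)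

_[_]ᵗ : Ty (suc n) → Ty n → Ty n
A [ B ]ᵗ = subᵗ (B ◂ var) A

ren : (Fin n → Fin n′) → (Fin m → Fin m′) → Tm n m → Tm n′ m′
ren ρ ξ (var x)      = var (ξ x)
ren ρ ξ (ƛ A t)      = ƛ (renᵗ ρ A) (ren ρ (lift 1 ξ) t)
ren ρ ξ (t · u)      = ren ρ ξ t · ren ρ ξ u
ren ρ ξ (Λ A t)      = Λ (renᵗ (lift 1 ρ) A) (ren (lift 1 ρ) ξ t)
ren ρ ξ (t ∙⟨ A ⟩ B) = ren ρ ξ t ∙⟨ renᵗ (lift 1 ρ) A ⟩ renᵗ ρ B

wk : Tm n m → Tm n (suc m)
wk = ren id suc

wkᵀ : Tm n m → Tm (suc n) m
wkᵀ = ren suc id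

sub : (Fin n → Ty n′) → (Fin m → Tm n′ m′) → Tm n m → Tm n′ m′
sub σ τ (var x)      = τ x
sub σ τ (ƛ A t)      = ƛ (subᵗ σ A) (sub σ (var zero ◂ (wk ∘ τ)) t)
sub σ τ (t · u)      = sub σ τ t · sub σ τ u
sub σ τ (Λ A t)      = Λ (subᵗ (liftᵗ σ) A) (sub (liftᵗ σ) (wkᵀ ∘ τ) t)
sub σ τ (t ∙⟨ A ⟩ B) = sub σ τ t ∙⟨ subᵗ (liftᵗ σ) A ⟩ subᵗ σ B

_[_] : Tm n (suc m) → Tm n m → Tm n m
t [ u ] = sub var (u ◂ var) t

_[_]ᵀ : Tm (suc n) m → Ty n → Tm n m
t [ B ]ᵀ = sub (B ◂ var) var t

data _⊢_∶_ {n m : ℕ} (Γ : Ctx n m) : Tm n m → Ty n → Set where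
  ⊢var : (x : Fin m) → Γ ⊢ var x ∶ lookup Γ x
  ⊢ƛ   : ∀ {A B t} → A ∷ Γ ⊢ t ∶ B → Γ ⊢ ƛ A t ∶ A ⊃ B
  ⊢·   : ∀ {A B t u} → Γ ⊢ t ∶ A ⊃ B → Γ ⊢ u ∶ A → Γ ⊢ t · u ∶ B
  ⊢Λ   : ∀ {A t} → Vec.map wkᵗ Γ ⊢ t ∶ A → Γ ⊢ Λ A t ∶ ∀′ A
  ⊢∙   : ∀ {A t} → Γ ⊢ t ∶ ∀′ A → (B : Ty n) → Γ ⊢ t ∙⟨ A ⟩ B ∶ A [ B ]ᵗ

------------------------------------------------------------------------
-- Term contexts, for capture-avoiding filling: the hole is index 0, and
-- U [ t ] fills it.

TmCtx : ℕ → ℕ → Set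
TmCtx n m = Tm n (suc m)

hole : TmCtx n m
hole = var zero

wkᶜ : TmCtx n m → TmCtx n (suc m)
wkᶜ = ren id (lift 1 suc)

_⟨_⟩ᶜ : TmCtx n m → TmCtx n m → TmCtx n m
U ⟨ V ⟩ᶜ = wkᶜ U [ V ]

------------------------------------------------------------------------
-- Universal polynomial formulas.  [A₁,…,Aₘ] ⇒ B is A₁ ⊃ … ⊃ Aₘ ⊃ B.  The
-- premise G = A₁ ⊃ … ⊃ Aₘ ⊃ X is given by the list of its Aⱼ, in which X
-- is not free because they live in the scope outside the quantifier.

_⇒_ : List (Ty n) → Ty n → Ty n
As ⇒ B = foldr _⊃_ B As

premise : List (Ty n) → Ty (suc n)
premise As = map wkᵗ As ⇒ var zero

poly : List (List (Ty n)) → Ty (suc n)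
poly Gs = map premise Gs ⇒ var zero

apps : Tm n m → List (Tm n m) → Tm n m
apps = foldl _·_

-- λ w₁ … λ wₘ. U[u w₁ ⋯ wₘ], with wⱼ of type Aⱼ
inside : TmCtx n m → List (Ty n) → Tm n m → Tm n m
inside U []       u = U [ u ]
inside U (A ∷ As) u = ƛ A (inside (wkᶜ U) As (wk u · var zero))

data _⊢_≃_∶_ {n m : ℕ} (Γ : Ctx n m) : Tm n m → Tm n m → Ty n → Set where

  ≃-refl  : ∀ {A t} → Γ ⊢ t ∶ A → Γ ⊢ t ≃ t ∶ A
  ≃-sym   : ∀ {A t u} → Γ ⊢ t ≃ u ∶ A → Γ ⊢ u ≃ t ∶ A
  ≃-trans : ∀ {A t u v} → Γ ⊢ t ≃ u ∶ A → Γ ⊢ u ≃ v ∶ A → Γ ⊢ t ≃ v ∶ A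

  ≃-ƛ : ∀ {A B t u} → A ∷ Γ ⊢ t ≃ u ∶ B → Γ ⊢ ƛ A t ≃ ƛ A u ∶ A ⊃ B
  ≃-· : ∀ {A B t t′ u u′} → Γ ⊢ t ≃ t′ ∶ A ⊃ B → Γ ⊢ u ≃ u′ ∶ A →
        Γ ⊢ t · u ≃ t′ · u′ ∶ B
  ≃-Λ : ∀ {A t u} → Vec.map wkᵗ Γ ⊢ t ≃ u ∶ A → Γ ⊢ Λ A t ≃ Λ A u ∶ ∀′ A
  ≃-∙ : ∀ {A t u} → Γ ⊢ t ≃ u ∶ ∀′ A → (B : Ty n) →
        Γ ⊢ t ∙⟨ A ⟩ B ≃ u ∙⟨ A ⟩ B ∶ A [ B ]ᵗ

  β⊃ : ∀ {A B t s} → A ∷ Γ ⊢ t ∶ B → Γ ⊢ s ∶ A → Γ ⊢ ƛ A t · s ≃ t [ s ] ∶ B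
  β∀ : ∀ {A t} → Vec.map wkᵗ Γ ⊢ t ∶ A → (B : Ty n) →
       Γ ⊢ Λ A t ∙⟨ A ⟩ B ≃ t [ B ]ᵀ ∶ A [ B ]ᵗ
  η⊃ : ∀ {A B t} → Γ ⊢ t ∶ A ⊃ B → Γ ⊢ t ≃ ƛ A (wk t · var zero) ∶ A ⊃ B
  η∀ : ∀ {A t} → Γ ⊢ t ∶ ∀′ A →
       Γ ⊢ t ≃ Λ A (wkᵀ t ∙⟨ renᵗ (lift 1 suc) A ⟩ var zero) ∶ ∀′ A

  ε  : ∀ {C D t} {U : TmCtx n m} (Gs : List (List (Ty n))) {us : List (Tm n m)} →
       Γ ⊢ t ∶ ∀′ (poly Gs) →
       Pointwise (λ As u → Γ ⊢ u ∶ premise As [ C ]ᵗ) Gs us →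
       C ∷ Γ ⊢ U ∶ D →
       Γ ⊢ U [ apps (t ∙⟨ poly Gs ⟩ C) us ]
         ≃ apps (t ∙⟨ poly Gs ⟩ D) (zipWith (inside U) Gs us) ∶ D

------------------------------------------------------------------------
-- _*, _*↓ and _♯ are the RP-, FF- and ESF-translations.

-- ∀′ (rp A B C) is ∀X. (A ⊃ B ⊃ X) ⊃ (C ⊃ X) ⊃ X with X not free in A, B, C.
rp : Ty n → Ty n → Ty n → Ty (suc n)
rp A B C = (wkᵗ A ⊃ wkᵗ B ⊃ var zero) ⊃ (wkᵗ C ⊃ var zero) ⊃ var zero

_*ᶠ : Form n → Ty n
var X *ᶠ      = var X
(A ⊃ B) *ᶠ    = A *ᶠ ⊃ B *ᶠ
(• A B C) *ᶠ  = ∀′ (rp (A *ᶠ) (B *ᶠ) (C *ᶠ))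

_*ᶜ : Vec (Form n) m → Ctx n m
_*ᶜ = Vec.map _*ᶠ

inj¹ : Ty n → Ty n → Ty n → Tm n m → Tm n m → Tm n m
inj¹ A B C t₁ t₂ =
  Λ (rp A B C) (ƛ (wkᵗ A ⊃ wkᵗ B ⊃ var zero) (ƛ (wkᵗ C ⊃ var zero)
    (var (suc zero) · wk (wk (wkᵀ t₁)) · wk (wk (wkᵀ t₂)))))

inj² : Ty n → Ty n → Ty n → Tm n m → Tm n m
inj² A B C t₃ =
  Λ (rp A B C) (ƛ (wkᵗ A ⊃ wkᵗ B ⊃ var zero) (ƛ (wkᵗ C ⊃ var zero)
    (var zero · wk (wk (wkᵀ t₃)))))

_* : {Γ : Vec (Form n) m} {A : Form n} → Γ ⊢• A → Tm n m
var x * = var x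
ƛ {A} t * = ƛ (A *ᶠ) (t *)
(t · u) * = t * · u *
ι¹ {A₁} {A₂} {A₃} t₁ t₂ * = inj¹ (A₁ *ᶠ) (A₂ *ᶠ) (A₃ *ᶠ) (t₁ *) (t₂ *)
ι² {A₁} {A₂} {A₃} t₃ *    = inj² (A₁ *ᶠ) (A₂ *ᶠ) (A₃ *ᶠ) (t₃ *)
δ {A₁} {A₂} {A₃} {C} t s₁ s₂ * =
  t * ∙⟨ rp (A₁ *ᶠ) (A₂ *ᶠ) (A₃ *ᶠ) ⟩ (C *ᶠ)
    · ƛ (A₁ *ᶠ) (ƛ (A₂ *ᶠ) (s₁ *)) · ƛ (A₃ *ᶠ) (s₂ *)

------------------------------------------------------------------------
-- FF-atomization.  Since types are recorded in terms, a derivation from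
-- assumptions in the fragment lies in the fragment when all types
-- annotating its term do.

data Fragᵗ {n : ℕ} : Ty n → Set where
  var : ∀ X → Fragᵗ (var X)
  _⊃_ : ∀ {A B} → Fragᵗ A → Fragᵗ B → Fragᵗ (A ⊃ B)
  ∀rp : ∀ {A B C} → Fragᵗ A → Fragᵗ B → Fragᵗ C → Fragᵗ (∀′ (rp A B C))

data Frag {n m : ℕ} : Tm n m → Set where
  var  : ∀ x → Frag (var x)
  ƛ    : ∀ {A t} → Fragᵗ A → Frag t → Frag (ƛ A t)
  _·_  : ∀ {t u} → Frag t → Frag u → Frag (t · u)
  Λ    : ∀ {A t} → Fragᵗ (∀′ A) → Frag t → Frag (Λ A t)
  inst : ∀ {A B t} → Frag t → Fragᵗ (∀′ A) → Fragᵗ B → Frag (t ∙⟨ A ⟩ B)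

-- (t F)↓ as a function of t↓, for t of type ∀′ (rp A B C).  The recursion
-- on F reaches (t F₂)↓ with t weakened under the new binders; atomization
-- commutes with weakening, so it is enough to weaken t↓.
ff : (A B C F : Ty n) → Tm n m → Tm n m
ff A B C (var Y)   t = t ∙⟨ rp A B C ⟩ var Y
ff A B C (F₁ ⊃ F₂) t =
  -- λ k₁ k₂ m. (t F₂)↓ (λ a b. k₁ a b m) (λ c. k₂ c m)
  ƛ (A ⊃ B ⊃ F₁ ⊃ F₂) (ƛ (C ⊃ F₁ ⊃ F₂) (ƛ F₁
    (ff A B C F₂ (wk (wk (wk t)))
      · ƛ A (ƛ B (var (suc (suc (suc (suc zero))))
                    · var (suc zero) · var zero · var (suc (suc zero))))
      · ƛ C (var (suc (suc zero)) · var zero · var (suc zero)))))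
ff A B C (∀′ F) t =
  -- λ k₁ k₂. Λ Z. (t F)↓ (λ a b. k₁ a b Z) (λ c. k₂ c Z)
  ƛ (A ⊃ B ⊃ ∀′ F) (ƛ (C ⊃ ∀′ F) (Λ F
    (ff (wkᵗ A) (wkᵗ B) (wkᵗ C) F (wkᵀ (wk (wk t)))
      · ƛ (wkᵗ A) (ƛ (wkᵗ B)
          ((var (suc (suc (suc zero))) · var (suc zero) · var zero)
            ∙⟨ renᵗ (lift 1 suc) F ⟩ var zero))
      · ƛ (wkᵗ C) ((var (suc zero) · var zero) ∙⟨ renᵗ (lift 1 suc) F ⟩ var zero))))

atomize : (t : Tm n m) → Frag t → Tm n m
atomize (var x)      (var x)                           = var x
atomize (ƛ A t)      (ƛ _ t∈)                          = ƛ A (atomize t t∈)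
atomize (t · u)      (t∈ · u∈)                         = atomize t t∈ · atomize u u∈
atomize (Λ A t)      (Λ _ t∈)                          = Λ A (atomize t t∈)
atomize (t ∙⟨ _ ⟩ F) (inst t∈ (∀rp {A} {B} {C} _ _ _) _) = ff A B C F (atomize t t∈)

renᵗ-cong : {ρ ρ′ : Fin n → Fin n′} → (∀ X → ρ X ≡ ρ′ X) → ∀ A → renᵗ ρ A ≡ renᵗ ρ′ A
renᵗ-cong e (var X) = cong var (e X)
renᵗ-cong e (A ⊃ B) = cong₂ _⊃_ (renᵗ-cong e A) (renᵗ-cong e B)
renᵗ-cong e (∀′ A)  = cong ∀′ (renᵗ-cong (λ { zero → refl ; (suc X) → cong suc (e X) }) A)

renᵗ-∘ : ∀ {n″} (ρ′ : Fin n′ → Fin n″) (ρ : Fin n → Fin n′) A →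
         renᵗ ρ′ (renᵗ ρ A) ≡ renᵗ (ρ′ ∘ ρ) A
renᵗ-∘ ρ′ ρ (var X) = refl
renᵗ-∘ ρ′ ρ (A ⊃ B) = cong₂ _⊃_ (renᵗ-∘ ρ′ ρ A) (renᵗ-∘ ρ′ ρ B)
renᵗ-∘ ρ′ ρ (∀′ A)  = cong ∀′ (trans (renᵗ-∘ (lift 1 ρ′) (lift 1 ρ) A)
                                (renᵗ-cong (λ { zero → refl ; (suc X) → refl }) A))

renᵗ-wkᵗ : (ρ : Fin n → Fin n′) (A : Ty n) → renᵗ (lift 1 ρ) (wkᵗ A) ≡ wkᵗ (renᵗ ρ A)
renᵗ-wkᵗ ρ A = trans (renᵗ-∘ (lift 1 ρ) suc A) (sym (renᵗ-∘ suc ρ A))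

renᵗ-rp : (ρ : Fin n → Fin n′) (A B C : Ty n) →
          renᵗ (lift 1 ρ) (rp A B C) ≡ rp (renᵗ ρ A) (renᵗ ρ B) (renᵗ ρ C)
renᵗ-rp ρ A B C rewrite renᵗ-wkᵗ ρ A | renᵗ-wkᵗ ρ B | renᵗ-wkᵗ ρ C = refl

renᵗ-frag : (ρ : Fin n → Fin n′) {A : Ty n} → Fragᵗ A → Fragᵗ (renᵗ ρ A)
renᵗ-frag ρ (var X) = var (ρ X)
renᵗ-frag ρ (A ⊃ B) = renᵗ-frag ρ A ⊃ renᵗ-frag ρ B
renᵗ-frag ρ (∀rp {A} {B} {C} a b c) =
  subst (Fragᵗ ∘ ∀′) (sym (renᵗ-rp ρ A B C))
    (∀rp (renᵗ-frag ρ a) (renᵗ-frag ρ b) (renᵗ-frag ρ c))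

ren-frag : (ρ : Fin n → Fin n′) (ξ : Fin m → Fin m′) {t : Tm n m} → Frag t → Frag (ren ρ ξ t)
ren-frag ρ ξ (var x)      = var (ξ x)
ren-frag ρ ξ (ƛ a t)      = ƛ (renᵗ-frag ρ a) (ren-frag ρ (lift 1 ξ) t)
ren-frag ρ ξ (t · u)      = ren-frag ρ ξ t · ren-frag ρ ξ u
ren-frag ρ ξ (Λ a t)      = Λ (renᵗ-frag ρ a) (ren-frag (lift 1 ρ) ξ t)
ren-frag ρ ξ (inst t a b) = inst (ren-frag ρ ξ t) (renᵗ-frag ρ a) (renᵗ-frag ρ b)

*ᶠ-frag : (A : Form n) → Fragᵗ (A *ᶠ)
*ᶠ-frag (var X)   = var X
*ᶠ-frag (A ⊃ B)   = *ᶠ-frag A ⊃ *ᶠ-frag B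
*ᶠ-frag (• A B C) = ∀rp (*ᶠ-frag A) (*ᶠ-frag B) (*ᶠ-frag C)

*-frag : {Γ : Vec (Form n) m} {A : Form n} (D : Γ ⊢• A) → Frag (D *)
*-frag (var x)   = var x
*-frag (ƛ {A} t) = ƛ (*ᶠ-frag A) (*-frag t)
*-frag (t · u)   = *-frag t · *-frag u
*-frag (ι¹ {A₁} {A₂} {A₃} t₁ t₂) =
  Λ (*ᶠ-frag (• A₁ A₂ A₃))
    (ƛ (wkᶠ A₁ ⊃ wkᶠ A₂ ⊃ var zero) (ƛ (wkᶠ A₃ ⊃ var zero)
      (var (suc zero) · wk³ (*-frag t₁) · wk³ (*-frag t₂))))
  where
  wkᶠ = λ A → renᵗ-frag suc (*ᶠ-frag A)
  wk³ : {t : Tm _ _} → Frag t → Frag (wk (wk (wkᵀ t)))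
  wk³ = ren-frag id suc ∘ ren-frag id suc ∘ ren-frag suc id
*-frag (ι² {A₁} {A₂} {A₃} t₃) =
  Λ (*ᶠ-frag (• A₁ A₂ A₃))
    (ƛ (wkᶠ A₁ ⊃ wkᶠ A₂ ⊃ var zero) (ƛ (wkᶠ A₃ ⊃ var zero)
      (var zero · wk³ (*-frag t₃))))
  where
  wkᶠ = λ A → renᵗ-frag suc (*ᶠ-frag A)
  wk³ : {t : Tm _ _} → Frag t → Frag (wk (wk (wkᵀ t)))
  wk³ = ren-frag id suc ∘ ren-frag id suc ∘ ren-frag suc id
*-frag (δ {A₁} {A₂} {A₃} {C} t s₁ s₂) =
  inst (*-frag t) (*ᶠ-frag (• A₁ A₂ A₃)) (*ᶠ-frag C)
    · ƛ (*ᶠ-frag A₁) (ƛ (*ᶠ-frag A₂) (*-frag s₁)) · ƛ (*ᶠ-frag A₃) (*-frag s₂)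

_*↓ : {Γ : Vec (Form n) m} {A : Form n} → Γ ⊢• A → Tm n m
D *↓ = atomize (D *) (*-frag D)

------------------------------------------------------------------------
-- ESF-translation.  The fresh variables shared by El B and In B are the
-- binders of In B: tyScope B and tmScope B m are the scopes at the hole
-- of In B, and intoᵗ B and into B embed the outer scopes into them.

tyScope : Ty n → ℕ
tyScope {n} (var _) = n
tyScope (_ ⊃ D)     = tyScope D
tyScope (∀′ D)      = tyScope D

tmScope : Ty n → ℕ → ℕ
tmScope (var _) m = m
tmScope (_ ⊃ D) m = tmScope D (suc m)
tmScope (∀′ D)  m = tmScope D m

intoᵗ : (B : Ty n) → Fin n → Fin (tyScope B)
intoᵗ (var _) X = X
intoᵗ (_ ⊃ D) X = intoᵗ D X
intoᵗ (∀′ D)  X = intoᵗ D (suc X)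

into : (B : Ty n) → Fin m → Fin (tmScope B m)
into (var _) x = x
into (_ ⊃ D) x = into D (suc x)
into (∀′ D)  x = into D x

at : (B : Ty n) → Fin (tyScope B)
at (var Z) = Z
at (_ ⊃ D) = at D
at (∀′ D)  = at D

-- In B t is the capturing In_B{t}.
In : (B : Ty n) → Tm (tyScope B) (tmScope B m) → Tm n m
In (var _) t = t
In (C ⊃ D) t = ƛ C (In D t)
In (∀′ D)  t = Λ D (In D t)

El : (B : Ty n) → TmCtx (tyScope B) (tmScope B m)
El (var _) = hole
El (C ⊃ D) = El D ⟨ hole · var (suc (into D zero)) ⟩ᶜ
El (∀′ D)  = El D ⟨ hole ∙⟨ renᵗ (lift 1 (intoᵗ (∀′ D))) D ⟩ var (intoᵗ D zero) ⟩ᶜ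

-- Given t and the two branches, In_C{t Z (λy₁.λy₂.El_C[s₁]) (λy₃.El_C[s₂])}
-- with Z = at C, for t of type ∀′ (rp A₁ A₂ A₃).
esf : (A₁ A₂ A₃ C : Ty n) → Tm n m → Tm n (suc (suc m)) → Tm n (suc m) → Tm n m
esf A₁ A₂ A₃ C t s₁ s₂ =
  In C (ren ρ ξ t ∙⟨ rp (renᵗ ρ A₁) (renᵗ ρ A₂) (renᵗ ρ A₃) ⟩ var (at C)
    · ƛ (renᵗ ρ A₁) (ƛ (renᵗ ρ A₂) (wkᶜ (wkᶜ (El C)) [ ren ρ (lift 2 ξ) s₁ ]))
    · ƛ (renᵗ ρ A₃) (wkᶜ (El C) [ ren ρ (lift 1 ξ) s₂ ]))
  where
  ρ = intoᵗ C
  ξ = into C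

_♯ : {Γ : Vec (Form n) m} {A : Form n} → Γ ⊢• A → Tm n m
var x ♯ = var x
ƛ {A} t ♯ = ƛ (A *ᶠ) (t ♯)
(t · u) ♯ = t ♯ · u ♯
ι¹ {A₁} {A₂} {A₃} t₁ t₂ ♯ = inj¹ (A₁ *ᶠ) (A₂ *ᶠ) (A₃ *ᶠ) (t₁ ♯) (t₂ ♯)
ι² {A₁} {A₂} {A₃} t₃ ♯    = inj² (A₁ *ᶠ) (A₂ *ᶠ) (A₃ *ᶠ) (t₃ ♯)
δ {A₁} {A₂} {A₃} {C} t s₁ s₂ ♯ =
  esf (A₁ *ᶠ) (A₂ *ᶠ) (A₃ *ᶠ) (C *ᶠ) (t ♯) (s₁ ♯) (s₂ ♯)

{-# OPTIONS --safe #-}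
module Submission where

-- Write elim F t u₁ u₂ for t F u₁ u₂ with t : ∀X. (A ⊃ B ⊃ X) ⊃ (C ⊃ X) ⊃ X.
-- Both equivalences come from one observation: η-expand an elimination once at
-- its result type and apply ε to the context [ ] x or [ ] X so created.  With
-- result type F ⊃ G this gives (elim-⊃)
--   elim (F ⊃ G) t u₁ u₂ ≃ λx. elim G t (λa b. u₁ a b x) (λc. u₂ c x),
-- and with result type ∀X. F it gives the analogous equation (elim-∀).
--
-- FF.  η-expanding t F with respect to its two branches gives
-- λk₁ k₂. elim F t k₁ k₂.  Then elim-⊃ and elim-∀ produce exactly the recursive
-- clauses of atomization, so t F ≃ ff F t by induction on F (ff-≃), and the
-- equivalence extends to every term of the fragment by congruence (atomize-≃).
--
-- ESF.  When the branches are λa b. s₁ and λc. s₂, the branches produced by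
-- elim-⊃ and elim-∀ β-reduce to λa b. s₁ x and λc. s₂ x, or to the same with X
-- for x.  Passing the eliminated variables to the branches in this way, one at
-- a time, is also how the capturing context In and the branches El[s₁], El[s₂]
-- decompose (esf-⊃, esf-∀).  Induction on the result type identifies the
-- elimination with its ESF form (esf-≃), and ♯-≃ is an induction on derivations.
--
-- The injections contain weakenings of their components, and stability under
-- weakening is not among the generating rules of the equivalence.  The
-- congruence of injections is instead obtained by β-expanding the injection to an
-- abstraction applied to the component to be replaced (≃-fill).
--
-- Equivalence is typed, but subject reduction is not needed: the inductions
-- carry the typing of the translated term along with the equivalence.

open import Data.Nat using (ℕ; suc)
open import Data.Fin using (Fin; zero; suc; lift)
open import Data.List using ([]; _∷_)
open import Data.List.Relation.Binary.Pointwise using ([]; _∷_)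
open import Data.Product using (_×_; _,_; proj₁; proj₂)
open import Data.Vec using (Vec; _∷_; lookup)
import Data.Vec as Vec
open import Data.Vec.Functional using () renaming (_∷_ to _◂_)
open import Data.Vec.Properties using (lookup-map)
open import Function using (id; _∘_)
open import Relation.Binary.PropositionalEquality
  using (_≡_; refl; sym; trans; cong; cong₂; subst)
open import Defs

private variable
  n n′ n″ m m′ m″ : ℕ
  Γ Δ : Ctx n m
  A B C F : Ty n
  t t′ u u₁ u₂ s s₁ s₂ : Tm n m

-- Renaming and substitution in types

-- The fusion laws take the composite as a separate function, known only to
-- agree pointwise, so that they apply without function extensionality.

lift-∘ : {f : Fin n′ → Fin n″} {g : Fin n → Fin n′} {h : Fin n → Fin n″} →
         (∀ X → f (g X) ≡ h X) → ∀ X → lift 1 f (lift 1 g X) ≡ lift 1 h X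
lift-∘ e zero    = refl
lift-∘ e (suc X) = cong suc (e X)

lift-id : {f : Fin n → Fin n} → (∀ X → f X ≡ X) → ∀ X → lift 1 f X ≡ X
lift-id e zero    = refl
lift-id e (suc X) = cong suc (e X)

renᵗ-id : {ρ : Fin n → Fin n} → (∀ X → ρ X ≡ X) → ∀ A → renᵗ ρ A ≡ A
renᵗ-id e (var X) = cong var (e X)
renᵗ-id e (A ⊃ B) = cong₂ _⊃_ (renᵗ-id e A) (renᵗ-id e B)
renᵗ-id e (∀′ A)  = cong ∀′ (renᵗ-id (lift-id e) A)

renᵗ-renᵗ : {ρ′ : Fin n′ → Fin n″} {ρ : Fin n → Fin n′} {ρ″ : Fin n → Fin n″} →
            (∀ X → ρ′ (ρ X) ≡ ρ″ X) → ∀ A → renᵗ ρ′ (renᵗ ρ A) ≡ renᵗ ρ″ A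
renᵗ-renᵗ e A = trans (renᵗ-∘ _ _ A) (renᵗ-cong e A)

liftᵗ-renᵗ : {σ : Fin n′ → Ty n″} {ρ : Fin n → Fin n′} {σ″ : Fin n → Ty n″} →
             (∀ X → σ (ρ X) ≡ σ″ X) → ∀ X → liftᵗ σ (lift 1 ρ X) ≡ liftᵗ σ″ X
liftᵗ-renᵗ e zero    = refl
liftᵗ-renᵗ e (suc X) = cong wkᵗ (e X)

subᵗ-renᵗ : {σ : Fin n′ → Ty n″} {ρ : Fin n → Fin n′} {σ″ : Fin n → Ty n″} →
            (∀ X → σ (ρ X) ≡ σ″ X) → ∀ A → subᵗ σ (renᵗ ρ A) ≡ subᵗ σ″ A
subᵗ-renᵗ e (var X) = e X
subᵗ-renᵗ e (A ⊃ B) = cong₂ _⊃_ (subᵗ-renᵗ e A) (subᵗ-renᵗ e B)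
subᵗ-renᵗ e (∀′ A)  = cong ∀′ (subᵗ-renᵗ (liftᵗ-renᵗ e) A)

renᵗ-liftᵗ : {ρ : Fin n′ → Fin n″} {σ : Fin n → Ty n′} {σ″ : Fin n → Ty n″} →
             (∀ X → renᵗ ρ (σ X) ≡ σ″ X) → ∀ X → renᵗ (lift 1 ρ) (liftᵗ σ X) ≡ liftᵗ σ″ X
renᵗ-liftᵗ e zero = refl
renᵗ-liftᵗ {ρ = ρ} {σ} e (suc X) = trans (renᵗ-wkᵗ ρ (σ X)) (cong wkᵗ (e X))

renᵗ-subᵗ : {ρ : Fin n′ → Fin n″} {σ : Fin n → Ty n′} {σ″ : Fin n → Ty n″} →
            (∀ X → renᵗ ρ (σ X) ≡ σ″ X) → ∀ A → renᵗ ρ (subᵗ σ A) ≡ subᵗ σ″ A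
renᵗ-subᵗ e (var X) = e X
renᵗ-subᵗ e (A ⊃ B) = cong₂ _⊃_ (renᵗ-subᵗ e A) (renᵗ-subᵗ e B)
renᵗ-subᵗ e (∀′ A)  = cong ∀′ (renᵗ-subᵗ (renᵗ-liftᵗ e) A)

liftᵗ-subᵗ : {σ′ : Fin n′ → Ty n″} {σ : Fin n → Ty n′} {σ″ : Fin n → Ty n″} →
             (∀ X → subᵗ σ′ (σ X) ≡ σ″ X) → ∀ X → subᵗ (liftᵗ σ′) (liftᵗ σ X) ≡ liftᵗ σ″ X
liftᵗ-subᵗ e zero = refl
liftᵗ-subᵗ {σ = σ} e (suc X) = trans (subᵗ-renᵗ (λ _ → refl) (σ X))
  (trans (sym (renᵗ-subᵗ (λ _ → refl) (σ X))) (cong wkᵗ (e X)))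

subᵗ-subᵗ : {σ′ : Fin n′ → Ty n″} {σ : Fin n → Ty n′} {σ″ : Fin n → Ty n″} →
            (∀ X → subᵗ σ′ (σ X) ≡ σ″ X) → ∀ A → subᵗ σ′ (subᵗ σ A) ≡ subᵗ σ″ A
subᵗ-subᵗ e (var X) = e X
subᵗ-subᵗ e (A ⊃ B) = cong₂ _⊃_ (subᵗ-subᵗ e A) (subᵗ-subᵗ e B)
subᵗ-subᵗ e (∀′ A)  = cong ∀′ (subᵗ-subᵗ (liftᵗ-subᵗ e) A)

liftᵗ-var : {σ : Fin n → Ty n′} {ρ : Fin n → Fin n′} →
            (∀ X → σ X ≡ var (ρ X)) → ∀ X → liftᵗ σ X ≡ var (lift 1 ρ X)
liftᵗ-var e zero    = refl
liftᵗ-var e (suc X) = cong wkᵗ (e X)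

subᵗ-var : {σ : Fin n → Ty n′} {ρ : Fin n → Fin n′} →
           (∀ X → σ X ≡ var (ρ X)) → ∀ A → subᵗ σ A ≡ renᵗ ρ A
subᵗ-var e (var X) = e X
subᵗ-var e (A ⊃ B) = cong₂ _⊃_ (subᵗ-var e A) (subᵗ-var e B)
subᵗ-var e (∀′ A)  = cong ∀′ (subᵗ-var (liftᵗ-var e) A)

subᵗ-id : {σ : Fin n → Ty n} → (∀ X → σ X ≡ var X) → ∀ A → subᵗ σ A ≡ A
subᵗ-id e A = trans (subᵗ-var e A) (renᵗ-id (λ _ → refl) A)

wkᵗ-[] : ∀ (A : Ty n) B → wkᵗ A [ B ]ᵗ ≡ A
wkᵗ-[] A B = trans (subᵗ-renᵗ (λ _ → refl) A) (subᵗ-id (λ _ → refl) A)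

-- The body of the weakening of ∀′ A, instantiated at the fresh variable, is A.
lift-[zero] : ∀ (A : Ty (suc n)) → renᵗ (lift 1 suc) A [ var zero ]ᵗ ≡ A
lift-[zero] A =
  trans (subᵗ-renᵗ (λ { zero → refl ; (suc X) → refl }) A) (subᵗ-id (λ _ → refl) A)

renᵗ-[] : (ρ : Fin n → Fin n′) (A : Ty (suc n)) (B : Ty n) →
          renᵗ (lift 1 ρ) A [ renᵗ ρ B ]ᵗ ≡ renᵗ ρ (A [ B ]ᵗ)
renᵗ-[] ρ A B = trans (subᵗ-renᵗ {σ″ = renᵗ ρ B ◂ (var ∘ ρ)}
                        (λ { zero → refl ; (suc X) → refl }) A)
                  (sym (renᵗ-subᵗ (λ { zero → refl ; (suc X) → refl }) A))

-- wkᶜ and filling send the type annotations of instantiations through identity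
-- renamings and substitutions, which vanish only propositionally.
lift-id-ann : ∀ (A : Ty (suc n)) → renᵗ (lift 1 id) A ≡ A
lift-id-ann = renᵗ-id (lift-id (λ _ → refl))

fill-ann : ∀ (A : Ty (suc n)) → subᵗ (liftᵗ var) A ≡ A
fill-ann A = trans (subᵗ-var (liftᵗ-var (λ _ → refl)) A) (lift-id-ann A)

fill-wkᶜ-ann : ∀ (A : Ty (suc n)) → subᵗ (liftᵗ var) (renᵗ (lift 1 id) A) ≡ A
fill-wkᶜ-ann A = trans (cong (subᵗ (liftᵗ var)) (lift-id-ann A)) (fill-ann A)

fill-wkᶜ²-ann : ∀ (A : Ty (suc n)) →
                subᵗ (liftᵗ var) (renᵗ (lift 1 id) (renᵗ (lift 1 id) A)) ≡ A
fill-wkᶜ²-ann A =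
  trans (cong (subᵗ (liftᵗ var) ∘ renᵗ (lift 1 id)) (lift-id-ann A)) (fill-wkᶜ-ann A)

rp-[] : ∀ (A B C F : Ty n) → rp A B C [ F ]ᵗ ≡ (A ⊃ B ⊃ F) ⊃ (C ⊃ F) ⊃ F
rp-[] A B C F rewrite wkᵗ-[] A F | wkᵗ-[] B F | wkᵗ-[] C F = refl

-- Renaming and substitution in terms

∙-cong : {t t′ : Tm n m} {A A′ : Ty (suc n)} {B B′ : Ty n} →
         t ≡ t′ → A ≡ A′ → B ≡ B′ → t ∙⟨ A ⟩ B ≡ t′ ∙⟨ A′ ⟩ B′
∙-cong refl refl refl = refl

ren-id : {ρ : Fin n → Fin n} {ξ : Fin m → Fin m} →
         (∀ X → ρ X ≡ X) → (∀ x → ξ x ≡ x) → ∀ t → ren ρ ξ t ≡ t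
ren-id p e (var x)      = cong var (e x)
ren-id p e (ƛ A t)      = cong₂ ƛ (renᵗ-id p A) (ren-id p (lift-id e) t)
ren-id p e (t · u)      = cong₂ _·_ (ren-id p e t) (ren-id p e u)
ren-id p e (Λ A t)      = cong₂ Λ (renᵗ-id (lift-id p) A) (ren-id (lift-id p) e t)
ren-id p e (t ∙⟨ A ⟩ B) = ∙-cong (ren-id p e t) (renᵗ-id (lift-id p) A) (renᵗ-id p B)

ren-ren : {ρ′ : Fin n′ → Fin n″} {ρ : Fin n → Fin n′} {ρ″ : Fin n → Fin n″}
          {ξ′ : Fin m′ → Fin m″} {ξ : Fin m → Fin m′} {ξ″ : Fin m → Fin m″} →
          (∀ X → ρ′ (ρ X) ≡ ρ″ X) → (∀ x → ξ′ (ξ x) ≡ ξ″ x) →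
          ∀ t → ren ρ′ ξ′ (ren ρ ξ t) ≡ ren ρ″ ξ″ t
ren-ren p e (var x)      = cong var (e x)
ren-ren p e (ƛ A t)      = cong₂ ƛ (renᵗ-renᵗ p A) (ren-ren p (lift-∘ e) t)
ren-ren p e (t · u)      = cong₂ _·_ (ren-ren p e t) (ren-ren p e u)
ren-ren p e (Λ A t)      =
  cong₂ Λ (renᵗ-renᵗ (lift-∘ p) A) (ren-ren (lift-∘ p) e t)
ren-ren p e (t ∙⟨ A ⟩ B) =
  ∙-cong (ren-ren p e t) (renᵗ-renᵗ (lift-∘ p) A) (renᵗ-renᵗ p B)

sub-ren : {σ : Fin n′ → Ty n″} {ρ : Fin n → Fin n′} {σ″ : Fin n → Ty n″}
          {τ : Fin m′ → Tm n″ m″} {ξ : Fin m → Fin m′} {τ″ : Fin m → Tm n″ m″} →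
          (∀ X → σ (ρ X) ≡ σ″ X) → (∀ x → τ (ξ x) ≡ τ″ x) →
          ∀ t → sub σ τ (ren ρ ξ t) ≡ sub σ″ τ″ t
sub-ren p e (var x) = e x
sub-ren p e (ƛ A t) = cong₂ ƛ (subᵗ-renᵗ p A)
  (sub-ren p (λ { zero → refl ; (suc x) → cong wk (e x) }) t)
sub-ren p e (t · u) = cong₂ _·_ (sub-ren p e t) (sub-ren p e u)
sub-ren p e (Λ A t) = cong₂ Λ (subᵗ-renᵗ (liftᵗ-renᵗ p) A)
  (sub-ren (liftᵗ-renᵗ p) (λ x → cong wkᵀ (e x)) t)
sub-ren p e (t ∙⟨ A ⟩ B) = ∙-cong (sub-ren p e t) (subᵗ-renᵗ (liftᵗ-renᵗ p) A) (subᵗ-renᵗ p B)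

ren-wk : (ρ : Fin n → Fin n′) (ξ : Fin m → Fin m′) (t : Tm n m) →
         ren ρ (lift 1 ξ) (wk t) ≡ wk (ren ρ ξ t)
ren-wk ρ ξ t = trans (ren-ren (λ _ → refl) (λ _ → refl) t)
                 (sym (ren-ren (λ _ → refl) (λ _ → refl) t))

ren-wkᵀ : (ρ : Fin n → Fin n′) (ξ : Fin m → Fin m′) (t : Tm n m) →
          ren (lift 1 ρ) ξ (wkᵀ t) ≡ wkᵀ (ren ρ ξ t)
ren-wkᵀ ρ ξ t = trans (ren-ren (λ _ → refl) (λ _ → refl) t)
                  (sym (ren-ren (λ _ → refl) (λ _ → refl) t))

ren-sub : {ρ : Fin n′ → Fin n″} {σ : Fin n → Ty n′} {σ″ : Fin n → Ty n″}
          {ξ : Fin m′ → Fin m″} {τ : Fin m → Tm n′ m′} {τ″ : Fin m → Tm n″ m″} →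
          (∀ X → renᵗ ρ (σ X) ≡ σ″ X) → (∀ x → ren ρ ξ (τ x) ≡ τ″ x) →
          ∀ t → ren ρ ξ (sub σ τ t) ≡ sub σ″ τ″ t
ren-sub p e (var x) = e x
ren-sub {τ = τ} p e (ƛ A t) = cong₂ ƛ (renᵗ-subᵗ p A) (ren-sub p
  (λ { zero → refl ; (suc x) → trans (ren-wk _ _ (τ x)) (cong wk (e x)) }) t)
ren-sub p e (t · u) = cong₂ _·_ (ren-sub p e t) (ren-sub p e u)
ren-sub {τ = τ} p e (Λ A t) = cong₂ Λ (renᵗ-subᵗ (renᵗ-liftᵗ p) A)
  (ren-sub (renᵗ-liftᵗ p) (λ x → trans (ren-wkᵀ _ _ (τ x)) (cong wkᵀ (e x))) t)
ren-sub p e (t ∙⟨ A ⟩ B) = ∙-cong (ren-sub p e t) (renᵗ-subᵗ (renᵗ-liftᵗ p) A) (renᵗ-subᵗ p B)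

sub-wk : (σ : Fin n → Ty n′) (τ : Fin m → Tm n′ m′) (t : Tm n m) →
         sub σ (var zero ◂ (wk ∘ τ)) (wk t) ≡ wk (sub σ τ t)
sub-wk σ τ t = trans (sub-ren (λ _ → refl) (λ _ → refl) t)
  (sym (ren-sub (λ X → renᵗ-id (λ _ → refl) (σ X)) (λ _ → refl) t))

sub-wkᵀ : (σ : Fin n → Ty n′) (τ : Fin m → Tm n′ m′) (t : Tm n m) →
          sub (liftᵗ σ) (wkᵀ ∘ τ) (wkᵀ t) ≡ wkᵀ (sub σ τ t)
sub-wkᵀ σ τ t = trans (sub-ren (λ _ → refl) (λ _ → refl) t)
  (sym (ren-sub (λ _ → refl) (λ _ → refl) t))

sub-sub : {σ′ : Fin n′ → Ty n″} {σ : Fin n → Ty n′} {σ″ : Fin n → Ty n″}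
          {τ′ : Fin m′ → Tm n″ m″} {τ : Fin m → Tm n′ m′} {τ″ : Fin m → Tm n″ m″} →
          (∀ X → subᵗ σ′ (σ X) ≡ σ″ X) → (∀ x → sub σ′ τ′ (τ x) ≡ τ″ x) →
          ∀ t → sub σ′ τ′ (sub σ τ t) ≡ sub σ″ τ″ t
sub-sub p e (var x) = e x
sub-sub {τ = τ} p e (ƛ A t) = cong₂ ƛ (subᵗ-subᵗ p A) (sub-sub p
  (λ { zero → refl ; (suc x) → trans (sub-wk _ _ (τ x)) (cong wk (e x)) }) t)
sub-sub p e (t · u) = cong₂ _·_ (sub-sub p e t) (sub-sub p e u)
sub-sub {τ = τ} p e (Λ A t) = cong₂ Λ (subᵗ-subᵗ (liftᵗ-subᵗ p) A)
  (sub-sub (liftᵗ-subᵗ p) (λ x → trans (sub-wkᵀ _ _ (τ x)) (cong wkᵀ (e x))) t)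
sub-sub p e (t ∙⟨ A ⟩ B) = ∙-cong (sub-sub p e t) (subᵗ-subᵗ (liftᵗ-subᵗ p) A) (subᵗ-subᵗ p B)

sub-var : {σ : Fin n → Ty n′} {ρ : Fin n → Fin n′}
          {τ : Fin m → Tm n′ m′} {ξ : Fin m → Fin m′} →
          (∀ X → σ X ≡ var (ρ X)) → (∀ x → τ x ≡ var (ξ x)) →
          ∀ t → sub σ τ t ≡ ren ρ ξ t
sub-var p e (var x) = e x
sub-var p e (ƛ A t) = cong₂ ƛ (subᵗ-var p A)
  (sub-var p (λ { zero → refl ; (suc x) → cong wk (e x) }) t)
sub-var p e (t · u) = cong₂ _·_ (sub-var p e t) (sub-var p e u)
sub-var p e (Λ A t) =
  cong₂ Λ (subᵗ-var (liftᵗ-var p) A) (sub-var (liftᵗ-var p) (λ x → cong wkᵀ (e x)) t)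
sub-var p e (t ∙⟨ A ⟩ B) = ∙-cong (sub-var p e t) (subᵗ-var (liftᵗ-var p) A) (subᵗ-var p B)

wk-[] : (t u : Tm n m) → wk t [ u ] ≡ t
wk-[] t u = trans (sub-ren (λ _ → refl) (λ _ → refl) t)
  (trans (sub-var (λ _ → refl) (λ _ → refl) t) (ren-id (λ _ → refl) (λ _ → refl) t))

-- Typing

cast-⊢ : A ≡ B → Γ ⊢ t ∶ A → Γ ⊢ t ∶ B
cast-⊢ {Γ = Γ} {t = t} = subst (Γ ⊢ t ∶_)

cast-≃ : A ≡ B → Γ ⊢ t ≃ u ∶ A → Γ ⊢ t ≃ u ∶ B
cast-≃ {Γ = Γ} {t = t} {u} = subst (Γ ⊢ t ≃ u ∶_)

-- The variable rule with its type given up to a propositional equality.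
⊢var′ : (x : Fin m) → lookup Γ x ≡ A → Γ ⊢ var x ∶ A
⊢var′ x refl = ⊢var x

-- The renamings ρ of type variables and ξ of term variables map the context Γ
-- into Δ: each variable of Γ goes to one of Δ with the renamed type.
Renames : (Fin n → Fin n′) → (Fin m → Fin m′) → Ctx n m → Ctx n′ m′ → Set
Renames ρ ξ Γ Δ = ∀ x → lookup Δ (ξ x) ≡ renᵗ ρ (lookup Γ x)

Renames-Λ : {ρ : Fin n → Fin n′} {ξ : Fin m → Fin m′} {Γ : Ctx n m} {Δ : Ctx n′ m′} →
            Renames ρ ξ Γ Δ → Renames (lift 1 ρ) ξ (Vec.map wkᵗ Γ) (Vec.map wkᵗ Δ)
Renames-Λ {ρ = ρ} {ξ} {Γ} {Δ} r x
  rewrite lookup-map (ξ x) wkᵗ Δ | lookup-map x wkᵗ Γ | r x = sym (renᵗ-wkᵗ ρ (lookup Γ x))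

⊢ren : {ρ : Fin n → Fin n′} {ξ : Fin m → Fin m′} {Γ : Ctx n m} {Δ : Ctx n′ m′} →
       Renames ρ ξ Γ Δ → Γ ⊢ t ∶ A → Δ ⊢ ren ρ ξ t ∶ renᵗ ρ A
⊢ren {ξ = ξ} r (⊢var x) = ⊢var′ (ξ x) (r x)
⊢ren r (⊢ƛ ⊢t)   = ⊢ƛ (⊢ren (λ { zero → refl ; (suc x) → r x }) ⊢t)
⊢ren r (⊢· ⊢t ⊢u) = ⊢· (⊢ren r ⊢t) (⊢ren r ⊢u)
⊢ren {Γ = Γ} {Δ} r (⊢Λ ⊢t) = ⊢Λ (⊢ren (Renames-Λ {Γ = Γ} {Δ} r) ⊢t)
⊢ren {ρ = ρ} r (⊢∙ {A} ⊢t B) = cast-⊢ (renᵗ-[] ρ A B) (⊢∙ (⊢ren r ⊢t) (renᵗ ρ B))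

⊢wk : Γ ⊢ t ∶ A → B ∷ Γ ⊢ wk t ∶ A
⊢wk {Γ = Γ} {A = A} ⊢t = cast-⊢ (renᵗ-id (λ _ → refl) A)
  (⊢ren (λ x → sym (renᵗ-id (λ _ → refl) (lookup Γ x))) ⊢t)

⊢wkᵀ : Γ ⊢ t ∶ A → Vec.map wkᵗ Γ ⊢ wkᵀ t ∶ wkᵗ A
⊢wkᵀ {Γ = Γ} = ⊢ren (λ x → lookup-map x wkᵗ Γ)

cast-terms : t ≡ t′ → u ≡ s → Γ ⊢ t ≃ u ∶ A → Γ ⊢ t′ ≃ s ∶ A
cast-terms refl refl e = e

≃-≡ : t ≡ u → Γ ⊢ t ∶ A → Γ ⊢ t ≃ u ∶ A
≃-≡ refl = ≃-refl

-- Eliminations of rp A B C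

-- The elimination of t : ∀′ (rp A B C) into F with branches u₁ and u₂.
elim : (A B C F : Ty n) → (t u₁ u₂ : Tm n m) → Tm n m
elim A B C F t u₁ u₂ = t ∙⟨ rp A B C ⟩ F · u₁ · u₂

elim-cong : {A A′ B B′ C C′ : Ty n} {t t′ u₁ u₁′ u₂ u₂′ : Tm n m} →
            A ≡ A′ → B ≡ B′ → C ≡ C′ → t ≡ t′ → u₁ ≡ u₁′ → u₂ ≡ u₂′ →
            elim A B C F t u₁ u₂ ≡ elim A′ B′ C′ F t′ u₁′ u₂′
elim-cong refl refl refl refl refl refl = refl

⊢∙rp : ∀ F → Γ ⊢ t ∶ ∀′ (rp A B C) →
       Γ ⊢ t ∙⟨ rp A B C ⟩ F ∶ (A ⊃ B ⊃ F) ⊃ (C ⊃ F) ⊃ F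
⊢∙rp F ⊢t = cast-⊢ (rp-[] _ _ _ F) (⊢∙ ⊢t F)

⊢elim-ƛ : Γ ⊢ t ∶ ∀′ (rp A B C) → B ∷ A ∷ Γ ⊢ s₁ ∶ F → C ∷ Γ ⊢ s₂ ∶ F →
          Γ ⊢ elim A B C F t (ƛ A (ƛ B s₁)) (ƛ C s₂) ∶ F
⊢elim-ƛ ⊢t ⊢s₁ ⊢s₂ = ⊢· (⊢· (⊢∙rp _ ⊢t) (⊢ƛ (⊢ƛ ⊢s₁))) (⊢ƛ ⊢s₂)

-- The left-hand instantiation may be replaced by any equivalent term, such as
-- an atomized one.
≃-elim : Γ ⊢ t ∙⟨ rp A B C ⟩ F ≃ t′ ∶ (A ⊃ B ⊃ F) ⊃ (C ⊃ F) ⊃ F →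
         Γ ⊢ u₁ ≃ s₁ ∶ A ⊃ B ⊃ F → Γ ⊢ u₂ ≃ s₂ ∶ C ⊃ F →
         Γ ⊢ elim A B C F t u₁ u₂ ≃ t′ · s₁ · s₂ ∶ F
≃-elim e e₁ e₂ = ≃-· (≃-· e e₁) e₂

-- The rule ε for ∀′ (rp A B C), which is ∀′ (poly [[A, B], [C]]).
ε-rp : {U : TmCtx n m} {G : Ty n} → Γ ⊢ t ∶ ∀′ (rp A B C) →
       Γ ⊢ u₁ ∶ A ⊃ B ⊃ F → Γ ⊢ u₂ ∶ C ⊃ F → F ∷ Γ ⊢ U ∶ G →
       Γ ⊢ U [ elim A B C F t u₁ u₂ ]
         ≃ elim A B C G t (inside U (A ∷ B ∷ []) u₁) (inside U (C ∷ []) u₂) ∶ G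
ε-rp {A = A} {B} {C} {F = F} ⊢t ⊢u₁ ⊢u₂ ⊢U =
  ε ((A ∷ B ∷ []) ∷ (C ∷ []) ∷ []) ⊢t
    ( cast-⊢ (sym (cong₂ (λ A B → A ⊃ B ⊃ F) (wkᵗ-[] A F) (wkᵗ-[] B F))) ⊢u₁
    ∷ cast-⊢ (sym (cong (_⊃ F) (wkᵗ-[] C F))) ⊢u₂ ∷ [])
    ⊢U

wk-elim : wk {n} {m} (elim A B C F t u₁ u₂) ≡ elim A B C F (wk t) (wk u₁) (wk u₂)
wk-elim {A = A} {B} {C} {F = F} {t = t} {u₁} {u₂} =
  cong (λ s → s · wk u₁ · wk u₂)
    (∙-cong refl (lift-id-ann (rp A B C)) (renᵗ-id (λ _ → refl) F))

-- η-expanding an elimination into F ⊃ G puts it into the context [ ] x, through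
-- which ε moves it down to an elimination into G.
elim-⊃ : {F G : Ty n} → Γ ⊢ t ∶ ∀′ (rp A B C) →
         Γ ⊢ u₁ ∶ A ⊃ B ⊃ F ⊃ G → Γ ⊢ u₂ ∶ C ⊃ F ⊃ G →
         Γ ⊢ elim A B C (F ⊃ G) t u₁ u₂
           ≃ ƛ F (elim A B C G (wk t)
               (ƛ A (ƛ B (wk (wk (wk u₁)) · var (suc zero) · var zero · var (suc (suc zero)))))
               (ƛ C (wk (wk u₂) · var zero · var (suc zero)))) ∶ F ⊃ G
elim-⊃ {t = t} {A = A} {B} {C} {F = F} {G} ⊢t ⊢u₁ ⊢u₂ = ≃-trans
  (cast-terms refl (cong (λ s → ƛ F (s · var zero)) (wk-elim {A = A} {B} {C} {F ⊃ G} {t}))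
    (η⊃ (⊢· (⊢· (⊢∙rp (F ⊃ G) ⊢t) ⊢u₁) ⊢u₂)))
  (≃-ƛ (ε-rp {U = hole · var (suc zero)} (⊢wk ⊢t) (⊢wk ⊢u₁) (⊢wk ⊢u₂)
    (⊢· (⊢var zero) (⊢var (suc zero)))))

-- The same for ∀′ F, with the context [ ] X.
elim-∀ : {F : Ty (suc n)} → Γ ⊢ t ∶ ∀′ (rp A B C) →
         Γ ⊢ u₁ ∶ A ⊃ B ⊃ ∀′ F → Γ ⊢ u₂ ∶ C ⊃ ∀′ F →
         Γ ⊢ elim A B C (∀′ F) t u₁ u₂
           ≃ Λ F (elim (wkᵗ A) (wkᵗ B) (wkᵗ C) F (wkᵀ t)
               (ƛ (wkᵗ A) (ƛ (wkᵗ B) ((wk (wk (wkᵀ u₁)) · var (suc zero) · var zero)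
                 ∙⟨ renᵗ (lift 1 suc) F ⟩ var zero)))
               (ƛ (wkᵗ C) ((wk (wkᵀ u₂) · var zero)
                 ∙⟨ renᵗ (lift 1 suc) F ⟩ var zero))) ∶ ∀′ F
elim-∀ {t = t} {A = A} {B} {C} {u₁ = u₁} {u₂} {F} ⊢t ⊢u₁ ⊢u₂ = ≃-trans
  (cast-terms refl
    (cong (λ R → Λ F ((wkᵀ t ∙⟨ R ⟩ ∀′ F′ · wkᵀ u₁ · wkᵀ u₂) ∙⟨ F′ ⟩ var zero))
      (renᵗ-rp suc A B C))
    (η∀ (⊢· (⊢· (⊢∙rp (∀′ F) ⊢t) ⊢u₁) ⊢u₂)))
  (≃-Λ (cast-terms
    (∙-cong refl (fill-ann F′) refl)
    (elim-cong refl refl refl refl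
      (cong (λ G → ƛ (wkᵗ A) (ƛ (wkᵗ B) ((wk (wk (wkᵀ u₁)) · var (suc zero) · var zero)
                     ∙⟨ G ⟩ var zero)))
        (fill-wkᶜ²-ann F′))
      (cong (λ G → ƛ (wkᵗ C) ((wk (wkᵀ u₂) · var zero) ∙⟨ G ⟩ var zero))
        (fill-wkᶜ-ann F′)))
    (ε-rp {U = hole ∙⟨ F′ ⟩ var zero} (cast-⊢ (cong ∀′ (renᵗ-rp suc A B C)) (⊢wkᵀ ⊢t))
      (⊢wkᵀ ⊢u₁) (⊢wkᵀ ⊢u₂)
      (cast-⊢ (lift-[zero] F) (⊢∙ (⊢var zero) (var zero))))))
  where
  F′ = renᵗ (lift 1 suc) F

-- FF-atomization

-- The η-expansion of an instantiation with respect to both branches.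
inst-η : Γ ⊢ t ∶ ∀′ (rp A B C) →
         Γ ⊢ t ∙⟨ rp A B C ⟩ F
           ≃ ƛ (A ⊃ B ⊃ F) (ƛ (C ⊃ F) (elim A B C F (wk (wk t)) (var (suc zero)) (var zero)))
           ∶ (A ⊃ B ⊃ F) ⊃ (C ⊃ F) ⊃ F
inst-η {t = t} {A = A} {B} {C} {F = F} ⊢t =
  ≃-trans (cast-terms refl (cong (λ s → ƛ (A ⊃ B ⊃ F) (s · var zero)) (wk-∙ t)) (η⊃ (⊢∙rp F ⊢t)))
    (≃-ƛ (cast-terms refl
      (cong (λ s → ƛ (C ⊃ F) (s · var (suc zero) · var zero)) (wk-∙ (wk t)))
      (η⊃ (⊢· (⊢∙rp F (⊢wk ⊢t)) (⊢var zero)))))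
  where
  wk-∙ : ∀ {k} (s : Tm _ k) → wk (s ∙⟨ rp A B C ⟩ F) ≡ wk s ∙⟨ rp A B C ⟩ F
  wk-∙ s = ∙-cong refl (lift-id-ann (rp A B C)) (renᵗ-id (λ _ → refl) F)

-- The recursion equations of ff are inst-η followed by elim-⊃ or elim-∀ applied
-- to the branch variables.
ff-≃ : ∀ F → Γ ⊢ t ∶ ∀′ (rp A B C) →
       (Γ ⊢ ff A B C F t ∶ (A ⊃ B ⊃ F) ⊃ (C ⊃ F) ⊃ F) ×
       (Γ ⊢ t ∙⟨ rp A B C ⟩ F ≃ ff A B C F t ∶ (A ⊃ B ⊃ F) ⊃ (C ⊃ F) ⊃ F)
ff-≃ (var Y) ⊢t = ⊢∙rp (var Y) ⊢t , ≃-refl (⊢∙rp (var Y) ⊢t)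
ff-≃ {Γ = Γ} {t = t} {A = A} {B} {C} (F₁ ⊃ F₂) ⊢t =
  let ⊢ff , ≃ff = ff-≃ F₂ (⊢wk (⊢wk (⊢wk ⊢t)))
  in ⊢ƛ (⊢ƛ (⊢ƛ (⊢· (⊢· ⊢ff ⊢k₁) ⊢k₂)))
   , ≃-trans (inst-η ⊢t) (≃-ƛ (≃-ƛ (≃-trans
       (elim-⊃ (⊢wk (⊢wk ⊢t)) (⊢var (suc zero)) (⊢var zero))
       (≃-ƛ (≃-elim ≃ff (≃-refl ⊢k₁) (≃-refl ⊢k₂))))))
  where
  Γ′ = F₁ ∷ (C ⊃ F₁ ⊃ F₂) ∷ (A ⊃ B ⊃ F₁ ⊃ F₂) ∷ Γ
  ⊢k₁ : Γ′ ⊢ ƛ A (ƛ B (var (suc (suc (suc (suc zero)))) · var (suc zero) · var zero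
                         · var (suc (suc zero)))) ∶ A ⊃ B ⊃ F₂
  ⊢k₁ = ⊢ƛ (⊢ƛ (⊢· (⊢· (⊢· (⊢var _) (⊢var _)) (⊢var _)) (⊢var _)))
  ⊢k₂ : Γ′ ⊢ ƛ C (var (suc (suc zero)) · var zero · var (suc zero)) ∶ C ⊃ F₂
  ⊢k₂ = ⊢ƛ (⊢· (⊢· (⊢var _) (⊢var _)) (⊢var _))
ff-≃ {Γ = Γ} {t = t} {A = A} {B} {C} (∀′ F) ⊢t =
  let ⊢ff , ≃ff = ff-≃ F (cast-⊢ (cong ∀′ (renᵗ-rp suc A B C)) (⊢wkᵀ (⊢wk (⊢wk ⊢t))))
  in ⊢ƛ (⊢ƛ (⊢Λ (⊢· (⊢· ⊢ff ⊢k₁) ⊢k₂)))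
   , ≃-trans (inst-η ⊢t) (≃-ƛ (≃-ƛ (≃-trans
       (elim-∀ (⊢wk (⊢wk ⊢t)) (⊢var (suc zero)) (⊢var zero))
       (≃-Λ (≃-elim ≃ff (≃-refl ⊢k₁) (≃-refl ⊢k₂))))))
  where
  Γ′ = Vec.map wkᵗ ((C ⊃ ∀′ F) ∷ (A ⊃ B ⊃ ∀′ F) ∷ Γ)
  ⊢k₁ : Γ′ ⊢ ƛ (wkᵗ A) (ƛ (wkᵗ B) ((var (suc (suc (suc zero))) · var (suc zero) · var zero)
                ∙⟨ renᵗ (lift 1 suc) F ⟩ var zero)) ∶ wkᵗ A ⊃ wkᵗ B ⊃ F
  ⊢k₁ = ⊢ƛ (⊢ƛ (cast-⊢ (lift-[zero] F)
          (⊢∙ (⊢· (⊢· (⊢var (suc (suc (suc zero)))) (⊢var _)) (⊢var _)) (var zero))))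
  ⊢k₂ : Γ′ ⊢ ƛ (wkᵗ C) ((var (suc zero) · var zero) ∙⟨ renᵗ (lift 1 suc) F ⟩ var zero)
           ∶ wkᵗ C ⊃ F
  ⊢k₂ = ⊢ƛ (cast-⊢ (lift-[zero] F) (⊢∙ (⊢· (⊢var (suc zero)) (⊢var _)) (var zero)))

atomize-≃ : Γ ⊢ t ∶ A → (t∈ : Frag t) →
            (Γ ⊢ atomize t t∈ ∶ A) × (Γ ⊢ t ≃ atomize t t∈ ∶ A)
atomize-≃ (⊢var x) (var x) = ⊢var x , ≃-refl (⊢var x)
atomize-≃ (⊢ƛ ⊢t) (ƛ _ t∈) =
  let ⊢t↓ , t≃ = atomize-≃ ⊢t t∈ in ⊢ƛ ⊢t↓ , ≃-ƛ t≃
atomize-≃ (⊢· ⊢t ⊢u) (t∈ · u∈) =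
  let ⊢t↓ , t≃ = atomize-≃ ⊢t t∈ ; ⊢u↓ , u≃ = atomize-≃ ⊢u u∈
  in ⊢· ⊢t↓ ⊢u↓ , ≃-· t≃ u≃
atomize-≃ (⊢Λ ⊢t) (Λ _ t∈) =
  let ⊢t↓ , t≃ = atomize-≃ ⊢t t∈ in ⊢Λ ⊢t↓ , ≃-Λ t≃
atomize-≃ (⊢∙ ⊢t F) (inst t∈ (∀rp {A} {B} {C} _ _ _) _) =
  let ⊢t↓ , t≃  = atomize-≃ ⊢t t∈
      ⊢ff , ff≃ = ff-≃ {A = A} {B} {C} F ⊢t↓
      rp≡       = sym (rp-[] A B C F)
  in cast-⊢ rp≡ ⊢ff , ≃-trans (≃-∙ t≃ F) (cast-≃ rp≡ ff≃)

-- The ESF elimination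

-- β-reduction of a renamed abstraction applied to a variable.
β-ren : {ρ : Fin n → Fin n′} {ξ : Fin m → Fin m′} {ξ′ : Fin (suc m) → Fin m′}
        {Γ : Ctx n m} {Δ : Ctx n′ m′} {x : Fin m′} →
        Renames ρ ξ Γ Δ → lookup Δ x ≡ renᵗ ρ A → (∀ y → (x ◂ ξ) y ≡ ξ′ y) →
        A ∷ Γ ⊢ s ∶ B → Δ ⊢ ren ρ ξ (ƛ A s) · var x ≃ ren ρ ξ′ s ∶ renᵗ ρ B
β-ren {s = s} {ξ′ = ξ′} {x = x} r x∶A e ⊢s = cast-terms refl
  (trans (sub-ren {τ″ = λ y → var (ξ′ y)} (λ _ → refl)
           (λ { zero → cong var (e zero) ; (suc y) → cong var (e (suc y)) }) s)
    (sub-var (λ _ → refl) (λ _ → refl) s))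
  (β⊃ (⊢ren (λ { zero → refl ; (suc y) → r y }) ⊢s) (⊢var′ x x∶A))

-- The redexes that elim-⊃ and elim-∀ create in abstracted branches: each branch
-- is weakened past its own arguments and applied to them.
β-branch₂ : {ρ : Fin n → Fin n′} {ξ : Fin m → Fin m′}
            {ξ′ : Fin (suc (suc m)) → Fin (suc (suc m′))}
            {Γ : Ctx n m} {Δ : Ctx n′ m′} {A′ B′ : Ty n′} → Renames ρ ξ Γ Δ →
            A′ ≡ renᵗ ρ A → B′ ≡ renᵗ ρ B → (∀ y → lift 2 ξ y ≡ ξ′ y) →
            B ∷ A ∷ Γ ⊢ s ∶ F →
            B′ ∷ A′ ∷ Δ ⊢ wk (wk (ren ρ ξ (ƛ A (ƛ B s)))) · var (suc zero) · var zero
                            ≃ ren ρ ξ′ s ∶ renᵗ ρ F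
β-branch₂ {ρ = ρ} {ξ} r A≡ B≡ e ⊢s = cast-terms
  (cong (λ u → u · var (suc zero) · var zero)
    (trans (sym (ren-ren (λ _ → refl) (λ _ → refl) _))
      (cong wk (sym (ren-ren (λ _ → refl) (λ _ → refl) _)))))
  refl
  (≃-trans
    (≃-· (β-ren {ρ = ρ} {ξ = λ y → suc (suc (ξ y))} r A≡ (λ _ → refl) (⊢ƛ ⊢s)) (≃-refl (⊢var′ zero B≡)))
    (β-ren (λ { zero → A≡ ; (suc y) → r y }) B≡
      (λ { zero → e zero ; (suc zero) → e (suc zero) ; (suc (suc y)) → e (suc (suc y)) }) ⊢s))

β-branch₁ : {ρ : Fin n → Fin n′} {ξ : Fin m → Fin m′} {ξ′ : Fin (suc m) → Fin (suc m′)}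
            {Γ : Ctx n m} {Δ : Ctx n′ m′} {C′ : Ty n′} → Renames ρ ξ Γ Δ →
            C′ ≡ renᵗ ρ C → (∀ y → lift 1 ξ y ≡ ξ′ y) → C ∷ Γ ⊢ s ∶ F →
            C′ ∷ Δ ⊢ wk (ren ρ ξ (ƛ C s)) · var zero ≃ ren ρ ξ′ s ∶ renᵗ ρ F
β-branch₁ {ρ = ρ} {ξ} r C≡ e ⊢s = cast-terms
  (cong (_· var zero) (sym (ren-ren (λ _ → refl) (λ _ → refl) _))) refl
  (β-ren {ρ = ρ} {ξ = suc ∘ ξ} r C≡
    (λ { zero → e zero ; (suc y) → e (suc y) }) ⊢s)

-- Composition of term contexts is substitution for the hole alone; filling it is
-- therefore associative, also under weakening of the contexts.
⟨⟩ᶜ-sub : (U V : TmCtx n m) → U ⟨ V ⟩ᶜ ≡ sub var (V ◂ (λ x → var (suc x))) U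
⟨⟩ᶜ-sub U V = sub-ren (λ _ → refl) (λ { zero → refl ; (suc _) → refl }) U

⟨⟩ᶜ-[] : (U V : TmCtx n m) (s : Tm n m) → U ⟨ V ⟩ᶜ [ s ] ≡ U [ V [ s ] ]
⟨⟩ᶜ-[] U V s = trans (cong (_[ s ]) (⟨⟩ᶜ-sub U V))
  (sub-sub (λ _ → refl) (λ { zero → refl ; (suc _) → refl }) U)

wkᶜ-⟨⟩ᶜ : (U V : TmCtx n m) → wkᶜ (U ⟨ V ⟩ᶜ) ≡ wkᶜ U ⟨ wkᶜ V ⟩ᶜ
wkᶜ-⟨⟩ᶜ U V = trans (cong wkᶜ (⟨⟩ᶜ-sub U V))
  (trans (ren-sub {σ″ = var} {τ″ = wkᶜ V ◂ (λ x → var (suc (suc x)))} (λ _ → refl)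
           (λ { zero → refl ; (suc _) → refl }) U)
    (sym (trans (⟨⟩ᶜ-sub (wkᶜ U) (wkᶜ V))
      (sub-ren (λ _ → refl) (λ { zero → refl ; (suc _) → refl }) U))))

wkᶜ-⟨⟩ᶜ-[] : (U V : TmCtx n m) (s : Tm n (suc m)) →
             wkᶜ (U ⟨ V ⟩ᶜ) [ s ] ≡ wkᶜ U [ wkᶜ V [ s ] ]
wkᶜ-⟨⟩ᶜ-[] U V s = trans (cong (_[ s ]) (wkᶜ-⟨⟩ᶜ U V)) (⟨⟩ᶜ-[] (wkᶜ U) (wkᶜ V) s)

wkᶜ²-⟨⟩ᶜ-[] : (U V : TmCtx n m) (s : Tm n (suc (suc m))) →
              wkᶜ (wkᶜ (U ⟨ V ⟩ᶜ)) [ s ] ≡ wkᶜ (wkᶜ U) [ wkᶜ (wkᶜ V) [ s ] ]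
wkᶜ²-⟨⟩ᶜ-[] U V s =
  trans (cong (λ W → wkᶜ W [ s ]) (wkᶜ-⟨⟩ᶜ U V)) (wkᶜ-⟨⟩ᶜ-[] (wkᶜ U) (wkᶜ V) s)

-- The recursion equations of esf hold syntactically: the variable that El passes
-- to a branch can instead be passed before recursing on the result type.
esf-var : ∀ {A B C} {t : Tm n m} {s₁ s₂} Z →
          esf A B C (var Z) t s₁ s₂ ≡ elim A B C (var Z) t (ƛ A (ƛ B s₁)) (ƛ C s₂)
esf-var {A = A} {B} {C} {t} {s₁} {s₂} Z
  rewrite renᵗ-id (λ _ → refl) A | renᵗ-id (λ _ → refl) B | renᵗ-id (λ _ → refl) C
  = elim-cong refl refl refl (ren-id (λ _ → refl) (λ _ → refl) t)
      (cong (ƛ A ∘ ƛ B) (ren-id (λ _ → refl)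
        (λ { zero → refl ; (suc zero) → refl ; (suc (suc _)) → refl }) s₁))
      (cong (ƛ C) (ren-id (λ _ → refl) (lift-id (λ _ → refl)) s₂))

esf-⊃ : ∀ {A B C} {t : Tm n m} {s₁ s₂} F G →
        esf A B C (F ⊃ G) t s₁ s₂
          ≡ ƛ F (esf A B C G (wk t) (ren id (lift 2 suc) s₁ · var (suc (suc zero)))
                                    (ren id (lift 1 suc) s₂ · var (suc zero)))
esf-⊃ {A = A} {B} {C} {t} {s₁} {s₂} F G = cong (ƛ F ∘ In G)
  (elim-cong refl refl refl
    (sym (ren-ren (λ _ → refl) (λ _ → refl) t))
    (cong₂ ƛ refl (cong₂ ƛ refl (trans (wkᶜ²-⟨⟩ᶜ-[] (El G) _ _)
      (cong (λ s → wkᶜ (wkᶜ (El G)) [ s · var (suc (suc (into G zero))) ])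
        (sym (ren-ren (λ _ → refl) (λ { zero → refl ; (suc zero) → refl ; (suc (suc _)) → refl }) s₁))))))
    (cong₂ ƛ refl (trans (wkᶜ-⟨⟩ᶜ-[] (El G) _ _)
      (cong (λ s → wkᶜ (El G) [ s · var (suc (into G zero)) ])
        (sym (ren-ren (λ _ → refl) (λ { zero → refl ; (suc _) → refl }) s₂))))))

esf-∀ : ∀ {A B C} {t : Tm n m} {s₁ s₂} F →
        esf A B C (∀′ F) t s₁ s₂
          ≡ Λ F (esf (wkᵗ A) (wkᵗ B) (wkᵗ C) F (wkᵀ t)
                  (wkᵀ s₁ ∙⟨ renᵗ (lift 1 suc) F ⟩ var zero)
                  (wkᵀ s₂ ∙⟨ renᵗ (lift 1 suc) F ⟩ var zero))
esf-∀ {A = A} {B} {C} {t} {s₁} {s₂} F = cong (Λ F ∘ In F)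
  (elim-cong (wk≡ A) (wk≡ B) (wk≡ C)
    (sym (ren-ren (λ _ → refl) (λ _ → refl) t))
    (cong₂ ƛ (wk≡ A) (cong₂ ƛ (wk≡ B) (trans (wkᶜ²-⟨⟩ᶜ-[] (El F) _ _)
      (cong (wkᶜ (wkᶜ (El F)) [_])
        (∙-cong (sym (ren-ren (λ _ → refl) (λ _ → refl) s₁))
          (trans (fill-wkᶜ²-ann F′) F′≡)
          refl)))))
    (cong₂ ƛ (wk≡ C) (trans (wkᶜ-⟨⟩ᶜ-[] (El F) _ _)
      (cong (wkᶜ (El F) [_])
        (∙-cong (sym (ren-ren (λ _ → refl) (λ _ → refl) s₂))
          (trans (fill-wkᶜ-ann F′) F′≡)
          refl)))))
  where
  wk≡ : ∀ D → renᵗ (intoᵗ (∀′ F)) D ≡ renᵗ (intoᵗ F) (wkᵗ D)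
  wk≡ D = sym (renᵗ-∘ _ _ D)
  F′ = renᵗ (lift 1 (intoᵗ (∀′ F))) F
  F′≡ : F′ ≡ renᵗ (lift 1 (intoᵗ F)) (renᵗ (lift 1 suc) F)
  F′≡ = sym (renᵗ-renᵗ (lift-∘ (λ _ → refl)) F)

-- Each step is elim-⊃ or elim-∀, then β in the branches, then the recursion
-- equation of esf.
esf-≃ : ∀ F → Γ ⊢ t ∶ ∀′ (rp A B C) → B ∷ A ∷ Γ ⊢ s₁ ∶ F → C ∷ Γ ⊢ s₂ ∶ F →
        (Γ ⊢ esf A B C F t s₁ s₂ ∶ F) ×
        (Γ ⊢ elim A B C F t (ƛ A (ƛ B s₁)) (ƛ C s₂) ≃ esf A B C F t s₁ s₂ ∶ F)
esf-≃ {Γ = Γ} (var Z) ⊢t ⊢s₁ ⊢s₂ =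
  let esf≡ = sym (esf-var Z) ; ⊢elim = ⊢elim-ƛ ⊢t ⊢s₁ ⊢s₂
  in subst (λ s → Γ ⊢ s ∶ var Z) esf≡ ⊢elim , ≃-≡ esf≡ ⊢elim
esf-≃ {Γ = Γ} {t = t} {A = A} {B} {C} {s₁ = s₁} {s₂} (F ⊃ G) ⊢t ⊢s₁ ⊢s₂ =
  let ⊢esf , ≃esf = esf-≃ G (⊢wk ⊢t) (⊢· ⊢s₁′ (⊢var (suc (suc zero)))) (⊢· ⊢s₂′ (⊢var (suc zero)))
      esf≡ = sym (esf-⊃ F G)
  in subst (λ s → Γ ⊢ s ∶ F ⊃ G) esf≡ (⊢ƛ ⊢esf)
   , cast-terms refl esf≡ (≃-trans (elim-⊃ ⊢t (⊢ƛ (⊢ƛ ⊢s₁)) (⊢ƛ ⊢s₂))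
       (≃-ƛ (≃-trans
         (≃-elim (≃-refl (⊢∙rp G (⊢wk ⊢t)))
           (≃-ƛ (≃-ƛ (≃-· β₁ (≃-refl (⊢var (suc (suc zero)))))))
           (≃-ƛ (≃-· β₂ (≃-refl (⊢var (suc zero))))))
         ≃esf)))
  where
  rid : ∀ {k} (D : Ty k) → D ≡ renᵗ id D
  rid D = sym (renᵗ-id (λ _ → refl) D)
  ⊢s₁′ : B ∷ A ∷ F ∷ Γ ⊢ ren id (lift 2 suc) s₁ ∶ F ⊃ G
  ⊢s₁′ = cast-⊢ (sym (rid (F ⊃ G)))
    (⊢ren (λ { zero → rid B ; (suc zero) → rid A ; (suc (suc x)) → rid _ }) ⊢s₁)
  ⊢s₂′ : C ∷ F ∷ Γ ⊢ ren id (lift 1 suc) s₂ ∶ F ⊃ G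
  ⊢s₂′ = cast-⊢ (sym (rid (F ⊃ G)))
    (⊢ren (λ { zero → rid C ; (suc x) → rid _ }) ⊢s₂)
  β₁ : B ∷ A ∷ F ∷ Γ ⊢ wk (wk (wk (ƛ A (ƛ B s₁)))) · var (suc zero) · var zero
         ≃ ren id (lift 2 suc) s₁ ∶ F ⊃ G
  β₁ = cast-≃ (sym (rid (F ⊃ G))) (β-branch₂ (λ x → rid _) (rid A) (rid B) (λ _ → refl) ⊢s₁)
  β₂ : C ∷ F ∷ Γ ⊢ wk (wk (ƛ C s₂)) · var zero ≃ ren id (lift 1 suc) s₂ ∶ F ⊃ G
  β₂ = cast-≃ (sym (rid (F ⊃ G))) (β-branch₁ (λ x → rid _) (rid C) (λ _ → refl) ⊢s₂)
esf-≃ {Γ = Γ} {t = t} {A = A} {B} {C} {s₁ = s₁} {s₂} (∀′ F) ⊢t ⊢s₁ ⊢s₂ =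
  let ⊢esf , ≃esf = esf-≃ F ⊢t′ (inst-zero ⊢s₁′) (inst-zero ⊢s₂′)
      esf≡ = sym (esf-∀ F)
  in subst (λ s → Γ ⊢ s ∶ ∀′ F) esf≡ (⊢Λ ⊢esf)
   , cast-terms refl esf≡ (≃-trans (elim-∀ ⊢t (⊢ƛ (⊢ƛ ⊢s₁)) (⊢ƛ ⊢s₂))
       (≃-Λ (≃-trans
         (≃-elim (≃-refl (⊢∙rp F ⊢t′))
           (≃-ƛ (≃-ƛ (cast-≃ (lift-[zero] F) (≃-∙ β₁ (var zero)))))
           (≃-ƛ (cast-≃ (lift-[zero] F) (≃-∙ β₂ (var zero)))))
         ≃esf)))
  where
  Γ′ = Vec.map wkᵗ Γ
  ⊢t′ : Γ′ ⊢ wkᵀ t ∶ ∀′ (rp (wkᵗ A) (wkᵗ B) (wkᵗ C))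
  ⊢t′ = cast-⊢ (cong ∀′ (renᵗ-rp suc A B C)) (⊢wkᵀ ⊢t)
  inst-zero : ∀ {k} {Δ : Ctx _ k} {s} → Δ ⊢ s ∶ wkᵗ (∀′ F) →
              Δ ⊢ s ∙⟨ renᵗ (lift 1 suc) F ⟩ var zero ∶ F
  inst-zero ⊢s = cast-⊢ (lift-[zero] F) (⊢∙ ⊢s (var zero))
  ⊢s₁′ : wkᵗ B ∷ wkᵗ A ∷ Γ′ ⊢ wkᵀ s₁ ∶ wkᵗ (∀′ F)
  ⊢s₁′ = ⊢wkᵀ ⊢s₁
  ⊢s₂′ : wkᵗ C ∷ Γ′ ⊢ wkᵀ s₂ ∶ wkᵗ (∀′ F)
  ⊢s₂′ = ⊢wkᵀ ⊢s₂
  r : Renames suc id Γ Γ′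
  r x = lookup-map x wkᵗ Γ
  β₁ : wkᵗ B ∷ wkᵗ A ∷ Γ′ ⊢ wk (wk (wkᵀ (ƛ A (ƛ B s₁)))) · var (suc zero) · var zero
         ≃ wkᵀ s₁ ∶ wkᵗ (∀′ F)
  β₁ = β-branch₂ r refl refl
         (λ { zero → refl ; (suc zero) → refl ; (suc (suc _)) → refl }) ⊢s₁
  β₂ : wkᵗ C ∷ Γ′ ⊢ wk (wkᵀ (ƛ C s₂)) · var zero ≃ wkᵀ s₂ ∶ wkᵗ (∀′ F)
  β₂ = β-branch₁ r refl (λ { zero → refl ; (suc _) → refl }) ⊢s₂

-- Congruence for injections

-- By β-expansion, equivalence is preserved by filling a term context.
≃-fill : {U : TmCtx n m} → A ∷ Γ ⊢ U ∶ B →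
         Γ ⊢ t ∶ A → Γ ⊢ t′ ∶ A → Γ ⊢ t ≃ t′ ∶ A → Γ ⊢ U [ t ] ≃ U [ t′ ] ∶ B
≃-fill ⊢U ⊢t ⊢t′ e =
  ≃-trans (≃-sym (β⊃ ⊢U ⊢t)) (≃-trans (≃-· (≃-refl (⊢ƛ ⊢U)) e) (β⊃ ⊢U ⊢t′))

⊢inj¹ : Γ ⊢ t ∶ A → Γ ⊢ u ∶ B → Γ ⊢ inj¹ A B C t u ∶ ∀′ (rp A B C)
⊢inj¹ ⊢t ⊢u = ⊢Λ (⊢ƛ (⊢ƛ (⊢· (⊢· (⊢var (suc zero)) (⊢wk (⊢wk (⊢wkᵀ ⊢t))))
                          (⊢wk (⊢wk (⊢wkᵀ ⊢u))))))

⊢inj² : Γ ⊢ t ∶ C → Γ ⊢ inj² A B C t ∶ ∀′ (rp A B C)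
⊢inj² ⊢t = ⊢Λ (⊢ƛ (⊢ƛ (⊢· (⊢var zero) (⊢wk (⊢wk (⊢wkᵀ ⊢t))))))

-- Substitution commutes with the weakening of a component under the three
-- binders of an injection.
sub-wk³ : (σ : Fin n → Ty n′) (τ : Fin m → Tm n′ m′) (t : Tm n m) →
          sub (liftᵗ σ) (var zero ◂ (wk ∘ (var zero ◂ (wk ∘ wkᵀ ∘ τ)))) (wk (wk (wkᵀ t)))
            ≡ wk (wk (wkᵀ (sub σ τ t)))
sub-wk³ σ τ t = trans (sub-wk _ _ (wk (wkᵀ t)))
  (cong wk (trans (sub-wk _ _ (wkᵀ t)) (cong wk (sub-wkᵀ σ τ t))))

inj¹-[] : (A B C : Ty n) (t u : Tm n (suc m)) (s : Tm n m) →
          inj¹ A B C t u [ s ] ≡ inj¹ A B C (t [ s ]) (u [ s ])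
inj¹-[] A B C t u s = cong₂ Λ (fill-ann (rp A B C))
  (cong₂ ƛ (fill-ann (wkᵗ A ⊃ wkᵗ B ⊃ var zero)) (cong₂ ƛ (fill-ann (wkᵗ C ⊃ var zero))
    (cong₂ _·_ (cong (var (suc zero) ·_) (sub-wk³ _ _ t)) (sub-wk³ _ _ u))))

inj²-[] : (A B C : Ty n) (t : Tm n (suc m)) (s : Tm n m) →
          inj² A B C t [ s ] ≡ inj² A B C (t [ s ])
inj²-[] A B C t s = cong₂ Λ (fill-ann (rp A B C))
  (cong₂ ƛ (fill-ann (wkᵗ A ⊃ wkᵗ B ⊃ var zero)) (cong₂ ƛ (fill-ann (wkᵗ C ⊃ var zero))
    (cong (var zero ·_) (sub-wk³ _ _ t))))

-- The two components are replaced one after the other, each by ≃-fill.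
≃-inj¹ : Γ ⊢ t ∶ A → Γ ⊢ t′ ∶ A → Γ ⊢ t ≃ t′ ∶ A →
         Γ ⊢ u ∶ B → Γ ⊢ s ∶ B → Γ ⊢ u ≃ s ∶ B →
         Γ ⊢ inj¹ A B C t u ≃ inj¹ A B C t′ s ∶ ∀′ (rp A B C)
≃-inj¹ {t = t} {A = A} {t′ = t′} {u = u} {B = B} {s = s} {C = C} ⊢t ⊢t′ t≃ ⊢u ⊢s u≃ = ≃-trans
  (cast-terms (fill₁ t) (fill₁ t′) (≃-fill (⊢inj¹ (⊢var zero) (⊢wk ⊢u)) ⊢t ⊢t′ t≃))
  (cast-terms (fill₂ u) (fill₂ s) (≃-fill (⊢inj¹ (⊢wk ⊢t′) (⊢var zero)) ⊢u ⊢s u≃))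
  where
  fill₁ : ∀ r → inj¹ A B C (var zero) (wk u) [ r ] ≡ inj¹ A B C r u
  fill₁ r = trans (inj¹-[] A B C (var zero) (wk u) r) (cong (inj¹ A B C r) (wk-[] u r))
  fill₂ : ∀ r → inj¹ A B C (wk t′) (var zero) [ r ] ≡ inj¹ A B C t′ r
  fill₂ r = trans (inj¹-[] A B C (wk t′) (var zero) r) (cong (λ q → inj¹ A B C q r) (wk-[] t′ r))

≃-inj² : Γ ⊢ t ∶ C → Γ ⊢ t′ ∶ C → Γ ⊢ t ≃ t′ ∶ C →
         Γ ⊢ inj² A B C t ≃ inj² A B C t′ ∶ ∀′ (rp A B C)
≃-inj² ⊢t ⊢t′ t≃ = cast-terms (inj²-[] _ _ _ (var zero) _) (inj²-[] _ _ _ (var zero) _)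
  (≃-fill (⊢inj² (⊢var zero)) ⊢t ⊢t′ t≃)

-- The translations of derivations

⊢* : {Γ : Vec (Form n) m} {A : Form n} (D : Γ ⊢• A) → Γ *ᶜ ⊢ D * ∶ A *ᶠ
⊢* {Γ = Γ} (var x) = ⊢var′ x (lookup-map x _*ᶠ Γ)
⊢* (ƛ t)       = ⊢ƛ (⊢* t)
⊢* (t · u)     = ⊢· (⊢* t) (⊢* u)
⊢* (ι¹ t₁ t₂)  = ⊢inj¹ (⊢* t₁) (⊢* t₂)
⊢* (ι² t₃)     = ⊢inj² (⊢* t₃)
⊢* (δ t s₁ s₂) = ⊢elim-ƛ (⊢* t) (⊢* s₁) (⊢* s₂)

♯-≃ : {Γ : Vec (Form n) m} {A : Form n} (D : Γ ⊢• A) →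
      (Γ *ᶜ ⊢ D ♯ ∶ A *ᶠ) × (Γ *ᶜ ⊢ D * ≃ D ♯ ∶ A *ᶠ)
♯-≃ (var x) = ⊢* (var x) , ≃-refl (⊢* (var x))
♯-≃ (ƛ t) = let ⊢t♯ , t≃ = ♯-≃ t in ⊢ƛ ⊢t♯ , ≃-ƛ t≃
♯-≃ (t · u) =
  let ⊢t♯ , t≃ = ♯-≃ t ; ⊢u♯ , u≃ = ♯-≃ u in ⊢· ⊢t♯ ⊢u♯ , ≃-· t≃ u≃
♯-≃ (ι¹ t₁ t₂) =
  let ⊢t₁♯ , t₁≃ = ♯-≃ t₁ ; ⊢t₂♯ , t₂≃ = ♯-≃ t₂
  in ⊢inj¹ ⊢t₁♯ ⊢t₂♯ , ≃-inj¹ (⊢* t₁) ⊢t₁♯ t₁≃ (⊢* t₂) ⊢t₂♯ t₂≃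
♯-≃ (ι² t₃) =
  let ⊢t₃♯ , t₃≃ = ♯-≃ t₃ in ⊢inj² ⊢t₃♯ , ≃-inj² (⊢* t₃) ⊢t₃♯ t₃≃
♯-≃ (δ {C = C} t s₁ s₂) =
  let ⊢t♯ , t≃ = ♯-≃ t ; ⊢s₁♯ , s₁≃ = ♯-≃ s₁ ; ⊢s₂♯ , s₂≃ = ♯-≃ s₂
      ⊢esf , esf≃ = esf-≃ (C *ᶠ) ⊢t♯ ⊢s₁♯ ⊢s₂♯
  in ⊢esf
   , ≃-trans (≃-elim (cast-≃ (rp-[] _ _ _ (C *ᶠ)) (≃-∙ t≃ (C *ᶠ))) (≃-ƛ (≃-ƛ s₁≃)) (≃-ƛ s₂≃))
       esf≃

corollary4p8 : ∀ {n m : ℕ} {Γ : Vec (Form n) m} {A : Form n} (D : Γ ⊢• A) →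
    (Γ *ᶜ ⊢ D * ≃ D *↓ ∶ A *ᶠ) × (Γ *ᶜ ⊢ D * ≃ D ♯ ∶ A *ᶠ)
corollary4p8 D = proj₂ (atomize-≃ (⊢* D) (*-frag D)) , proj₂ (♯-≃ D)
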